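{- There exist connected matroids $\mathcal{M}$, $\mathcal{M}'$, $\mathcal{M}''$ of the same rank $d$ on the same ground set $[n]$ such that $\mathcal{M}'$ is an initial matroid of $\mathcal{M}$ and $\mathcal{M}''$ is an initial matroid of $\mathcal{M}'$, but $\mathcal{M}''$ is not an initial matroid of $\mathcal{M}$. (That is, the relation "is an initial matroid of" is not transitive, even among connected matroids.)
   Context: Let $\mathcal{M}$ be a matroid of rank $d$ on $[n]$ with set of bases $\mathcal{B}$. The Dressian $\mathrm{Dr}_{\mathcal{M}}\subset\mathbb{R}^{\mathcal{B}}$ is the set of all $v\in\mathbb{R}^{\mathcal{B}}$ such that, extending $v$ by $v_\sigma=\infty$ for $d$-subsets $\sigma\notin\mathcal{B}$, for every $S\in\binom{[n]}{d-2}$ and distinct $i,j,k,l\in[n]\setminus S$ the minimum of $v_{Sij}+v_{Skl}$, $v_{Sik}+v_{Sjl}$, $v_{Sil}+v_{Sjk}$ is attained at least twice (or is $\infty$). Here $Sij$ denotes $S\cup\{i,j\}$. For $v\in\mathrm{Dr}_{\mathcal{M}}$, the initial matroid $\mathcal{M}_v$ is the matroid on $[n]$ with bases $\mathcal{B}_v=\{\sigma\in\mathcal{B} : v_\sigma \text{ is minimal}\}$. A matroid $\mathcal{M}'$ is an initial matroid of $\mathcal{M}$ if $\mathcal{M}'=\mathcal{M}_v$ for some $v\in\mathrm{Dr}_{\mathcal{M}}$. A matroid is connected if it is not a direct sum of two matroids on nonempty ground sets. -}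

module Defs where

open import Data.Fin.Base using (Fin)
open import Data.Fin.Subset
open import Data.List.Base using (List; []; _∷_; lookup)
open import Data.List.Relation.Unary.All using (All)
open import Data.List.Relation.Unary.Unique.Propositional using (Unique)
open import Data.Maybe.Base using (zipWith)
open import Data.Nat.Base as ℕ using (ℕ)
import Data.Nat.Properties as ℕ
open import Data.Product.Base using (Σ-syntax; ∃; ∃₂; ∃-syntax; _×_; _,_; proj₁; proj₂)
open import Data.Rational.Base as ℚ using (ℚ; 0ℚ; ½)
import Data.Rational.Properties as ℚ
open import Data.Rational.Solver using (module +-*-Solver)
open import Function.Bundles using (_⇔_)
open import Relation.Binary.PropositionalEquality
open import Relation.Nullary using (¬_; yes; no)
open import Relation.Nullary.Construct.Add.Supremum using (_⁺; ⊤⁺; [_])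
open import Relation.Unary using (Decidable)

-- Real numbers: Cauchy sequences of rationals, taken up to the
-- equivalence induced by the preorder _≤ℝ_ (x and y are the same real
-- when x ≤ℝ y and y ≤ℝ x).

IsCauchy : (ℕ → ℚ) → Set
IsCauchy x = ∀ ε → 0ℚ ℚ.< ε →
  ∃[ N ] (∀ m n → N ℕ.≤ m → N ℕ.≤ n → ℚ.∣ x m ℚ.- x n ∣ ℚ.< ε)

record ℝ : Set where
  constructor mkℝ
  field
    seq    : ℕ → ℚ
    cauchy : IsCauchy seq

open ℝ public

infix 4 _≤ℝ_
_≤ℝ_ : ℝ → ℝ → Set
x ≤ℝ y = ∀ ε → 0ℚ ℚ.< ε →
  ∃[ N ] (∀ n → N ℕ.≤ n → seq x n ℚ.≤ seq y n ℚ.+ ε)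

+-cauchy : ∀ {x y} → IsCauchy x → IsCauchy y →
           IsCauchy (λ n → x n ℚ.+ y n)
+-cauchy {x} {y} cx cy ε ε>0 = M ℕ.⊔ N , bound
  where
  δ : ℚ
  δ = ε ℚ.* ½

  δ>0 : 0ℚ ℚ.< δ
  δ>0 = subst (ℚ._< δ) (ℚ.*-zeroˡ ½) (ℚ.*-monoˡ-<-pos ½ ε>0)

  δ+δ≡ε : δ ℚ.+ δ ≡ ε
  δ+δ≡ε = trans (sym (ℚ.*-distribˡ-+ ε ½ ½)) (ℚ.*-identityʳ ε)

  M = proj₁ (cx δ δ>0)
  N = proj₁ (cy δ δ>0)

  regroup : ∀ a b c d →
            (a ℚ.+ b) ℚ.- (c ℚ.+ d) ≡ (a ℚ.- c) ℚ.+ (b ℚ.- d)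
  regroup = solve 4 (λ a b c d →
    (a :+ b) :- (c :+ d) := (a :- c) :+ (b :- d)) refl
    where open +-*-Solver

  bound : ∀ m n → M ℕ.⊔ N ℕ.≤ m → M ℕ.⊔ N ℕ.≤ n →
          ℚ.∣ (x m ℚ.+ y m) ℚ.- (x n ℚ.+ y n) ∣ ℚ.< ε
  bound m n p q = begin-strict
    ℚ.∣ (x m ℚ.+ y m) ℚ.- (x n ℚ.+ y n) ∣
      ≡⟨ cong ℚ.∣_∣ (regroup (x m) (y m) (x n) (y n)) ⟩
    ℚ.∣ (x m ℚ.- x n) ℚ.+ (y m ℚ.- y n) ∣
      ≤⟨ ℚ.∣p+q∣≤∣p∣+∣q∣ (x m ℚ.- x n) (y m ℚ.- y n) ⟩
    ℚ.∣ x m ℚ.- x n ∣ ℚ.+ ℚ.∣ y m ℚ.- y n ∣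
      <⟨ ℚ.+-mono-<
           (proj₂ (cx δ δ>0) m n (ℕ.m⊔n≤o⇒m≤o M N p) (ℕ.m⊔n≤o⇒m≤o M N q))
           (proj₂ (cy δ δ>0) m n (ℕ.m⊔n≤o⇒n≤o M N p) (ℕ.m⊔n≤o⇒n≤o M N q)) ⟩
    δ ℚ.+ δ
      ≡⟨ δ+δ≡ε ⟩
    ε ∎
    where open ℚ.≤-Reasoning

infixl 6 _+ℝ_
_+ℝ_ : ℝ → ℝ → ℝ
x +ℝ y = mkℝ (λ n → seq x n ℚ.+ seq y n) (+-cauchy {seq x} {seq y} (cauchy x) (cauchy y))

-- ℝ ∪ {∞}, with ⊤⁺ as ∞

ℝ∞ : Set
ℝ∞ = ℝ ⁺

open import Relation.Binary.Construct.Add.Supremum.NonStrict _≤ℝ_ public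
  using () renaming (_≤⁺_ to _≤∞_)

-- `zipWith` on `Maybe`: the sum is ∞ as soon as one summand is.
infixl 6 _+∞_
_+∞_ : ℝ∞ → ℝ∞ → ℝ∞
_+∞_ = zipWith _+ℝ_

-- Two different positions both attain the minimum. This includes the
-- case in which the minimum is ∞, since then all entries are ∞.
MinAttainedTwice : List ℝ∞ → Set
MinAttainedTwice ts =
  ∃₂ λ a b → a ≢ b × IsMin a × IsMin b
  where
  IsMin : Fin _ → Set
  IsMin a = ∀ c → lookup ts a ≤∞ lookup ts c

-- Matroids of rank d whose ground set is a subset E of [n] = Fin n; a
-- matroid on [n] itself has E = ⊤. Allowing smaller ground sets is what
-- lets the summands of a direct sum be matroids in the same sense.
record Matroid {n : ℕ} (E : Subset n) (d : ℕ) : Set₁ where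
  field
    Basis    : Subset n → Set
    basis?   : Decidable Basis
    ground   : ∀ {σ} → Basis σ → σ ⊆ E
    rank     : ∀ {σ} → Basis σ → ∣ σ ∣ ≡ d
    nonempty : ∃ Basis
    exchange : ∀ {σ τ} → Basis σ → Basis τ → ∀ {x} → x ∈ σ → x ∉ τ →
               ∃[ y ] (y ∈ τ × y ∉ σ × Basis ((σ - x) ∪ ⁅ y ⁆))

open Matroid public

IsDirectSum : ∀ {n d d₁ d₂} {E E₁ E₂ : Subset n} →
              Matroid E d → Matroid E₁ d₁ → Matroid E₂ d₂ → Set
IsDirectSum {E = E} {E₁} {E₂} M M₁ M₂ =
  E₁ ∩ E₂ ≡ ⊥ ×
  E₁ ∪ E₂ ≡ E ×
  (∀ σ → Basis M σ ⇔
         (∃₂ λ σ₁ σ₂ → Basis M₁ σ₁ × Basis M₂ σ₂ × σ ≡ σ₁ ∪ σ₂))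

Connected : ∀ {n d} {E : Subset n} → Matroid E d → Set₁
Connected {n} M =
  ¬ (Σ[ E₁ ∈ Subset n ] Σ[ E₂ ∈ Subset n ] ∃₂ λ d₁ d₂ →
     Σ[ M₁ ∈ Matroid E₁ d₁ ] Σ[ M₂ ∈ Matroid E₂ d₂ ]
     Nonempty E₁ × Nonempty E₂ × IsDirectSum M M₁ M₂)

module _ {n d : ℕ} (M : Matroid {n} ⊤ d) where

  -- ℝ^𝓑. The irrelevant argument makes the value at σ independent of
  -- the proof that σ is a basis.
  Weight : Set
  Weight = (σ : Subset n) → .(Basis M σ) → ℝ

  extend : Weight → Subset n → ℝ∞
  extend v σ with basis? M σ
  ... | yes b = [ v σ b ]
  ... | no  _ = ⊤⁺

  -- The size of S is d - 2; for d < 2 there is no such S.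
  InDressian : Weight → Set
  InDressian v =
    ∀ (S : Subset n) → 2 ℕ.+ ∣ S ∣ ≡ d →
    ∀ i j k l → Unique (i ∷ j ∷ k ∷ l ∷ []) →
    All (_∉ S) (i ∷ j ∷ k ∷ l ∷ []) →
    let w = λ a b → extend v (S ∪ ⁅ a ⁆ ∪ ⁅ b ⁆) in
    MinAttainedTwice
      ((w i j +∞ w k l) ∷ (w i k +∞ w j l) ∷ (w i l +∞ w j k) ∷ [])

  InitialBasis : Weight → Subset n → Set
  InitialBasis v σ =
    Σ[ b ∈ Basis M σ ] (∀ τ (c : Basis M τ) → v σ b ≤ℝ v τ c)

-- M′ = M_v for some v in the Dressian of M, matroids on [n] being equal
-- when they have the same bases.
_IsInitialMatroidOf_ : ∀ {n d} → Matroid {n} ⊤ d → Matroid {n} ⊤ d → Set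
M′ IsInitialMatroidOf M =
  ∃[ v ] (InDressian M v × (∀ σ → Basis M′ σ ⇔ InitialBasis M v σ))

{-# OPTIONS --safe #-}

-- Let ABCD be a quadrangle in the plane with O = AB ∩ CD, I = AD ∩ BC, P a
-- point of AC and Q a point of BD.  In M exactly these six lines are
-- dependent; in M′ the points A, B, C, D are parallel and otherwise the
-- position is generic; in M″ the points O, P and the class ABCD are moreover
-- collinear.  Both degenerations are induced by the amount by which a basis
-- exceeds the newly imposed rank bound.
--
-- In the Dressian of M, six three-term relations with an infinite term
-- add up to v(OPA) + v(IQB) = v(IPA) + v(OQB): seen from the collapsed
-- quadrangle, the diagonals AC and BD and the sides through O and I satisfy a
-- cross-ratio condition of which M′ knows nothing.  If v is minimal exactly on
-- M″, then IQB, IPA and OQB attain the minimum, hence so does OPA, which is not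
-- a basis of M″.

module Submission where

open import Defs
open import Algebra.Properties.Monoid.Mult using (×-homo-+)
open import Data.Empty using (⊥)
open import Data.Fin.Base using (Fin)
open import Data.Fin.Patterns
import Data.Fin.Properties as Fin
open import Data.Fin.Subset renaming (⊥ to ∅)
open import Data.Fin.Subset.Properties
open import Data.List.Base using (List; []; _∷_; lookup)
open import Data.List.Relation.Unary.All as All using (All; []; _∷_)
open import Data.List.Relation.Unary.AllPairs using ([]; _∷_)
import Data.List.Relation.Unary.Unique.DecPropositional
open import Data.Maybe.Base as Maybe using (Maybe; just; nothing; zipWith)
open import Data.Nat.Base as ℕ using (ℕ; zero; suc; z≤n; s≤s; _∸_)
import Data.Nat.Properties as ℕ
open import Data.Product.Base using (Σ-syntax; ∃₂; ∃-syntax; _×_; _,_; proj₁; proj₂; uncurry)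
open import Data.Rational.Base as ℚ using (ℚ; 0ℚ; 1ℚ; ½)
import Data.Rational.Properties as ℚ
open import Data.Rational.Solver using (module +-*-Solver)
open import Data.Sum.Base using (inj₁; inj₂; [_,_]′)
open import Function.Base using (_∘_; case_of_)
open import Function.Bundles using (_⇔_; mk⇔; module Equivalence)
open import Relation.Binary.Construct.Add.Supremum.NonStrict using (_≤⊤⁺; ≤⁺-dec)
  renaming ([_] to ≤[_]; _≤⁺_ to Sup≤)
open import Relation.Binary.PropositionalEquality
open import Relation.Nullary using (¬_; Dec; yes; no; contradiction)
open import Relation.Nullary.Construct.Add.Supremum using (⊤⁺; [_])
open import Relation.Nullary.Decidable
  using (True; toWitness; from-yes; from-no; map′; decidable-stable; _×-dec_; _→-dec_; ¬?)
open import Relation.Unary using (Decidable)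

open import Algebra.Definitions.RawMonoid ℚ.+-0-rawMonoid using ()
  renaming (_×_ to _·_)
open Data.List.Relation.Unary.Unique.DecPropositional (Fin._≟_ {8}) using (unique?)

-- Order and addition of Cauchy sequences

½+½ : ∀ ε → ε ℚ.* ½ ℚ.+ ε ℚ.* ½ ≡ ε
½+½ ε = trans (sym (ℚ.*-distribˡ-+ ε ½ ½)) (ℚ.*-identityʳ ε)

half-positive : ∀ {ε} → 0ℚ ℚ.< ε → 0ℚ ℚ.< ε ℚ.* ½
half-positive {ε} ε>0 = subst (ℚ._< ε ℚ.* ½) (ℚ.*-zeroˡ ½) (ℚ.*-monoˡ-<-pos ½ ε>0)

-- Each hypothesis is invoked with ε/2 and the larger of the two thresholds is taken, so
-- consequences of two inequalities reduce to a calculation in ℚ at one index.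
≤ℝ-combine : ∀ {x y z w u v : ℝ} →
  (∀ n δ → seq x n ℚ.≤ seq y n ℚ.+ δ → seq z n ℚ.≤ seq w n ℚ.+ δ →
           seq u n ℚ.≤ seq v n ℚ.+ (δ ℚ.+ δ)) →
  x ≤ℝ y → z ≤ℝ w → u ≤ℝ v
≤ℝ-combine {u = u} {v} f x≤y z≤w ε ε>0 = proj₁ p ℕ.⊔ proj₁ q , λ n N≤n →
  subst (λ η → seq u n ℚ.≤ seq v n ℚ.+ η) (½+½ ε)
    (f n (ε ℚ.* ½)
      (proj₂ p n (ℕ.m⊔n≤o⇒m≤o (proj₁ p) (proj₁ q) N≤n))
      (proj₂ q n (ℕ.m⊔n≤o⇒n≤o (proj₁ p) (proj₁ q) N≤n)))
  where
  p = x≤y (ε ℚ.* ½) (half-positive ε>0)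
  q = z≤w (ε ℚ.* ½) (half-positive ε>0)

≤ℝ-trans : ∀ {x y z : ℝ} → x ≤ℝ y → y ≤ℝ z → x ≤ℝ z
≤ℝ-trans {x} {y} {z} = ≤ℝ-combine {x} {y} {y} {z} {x} {z} λ n δ x≤y y≤z → begin
  seq x n                      ≤⟨ x≤y ⟩
  seq y n ℚ.+ δ                ≤⟨ ℚ.+-monoˡ-≤ δ y≤z ⟩
  seq z n ℚ.+ δ ℚ.+ δ          ≡⟨ ℚ.+-assoc (seq z n) δ δ ⟩
  seq z n ℚ.+ (δ ℚ.+ δ)        ∎
  where open ℚ.≤-Reasoning

-- Replacing `w` by the larger `y` leaves a common summand, which is subtracted termwise in ℚ. This
-- is the form in which an equality of two-term sums carries an inequality from one pair of summands
-- to the other.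
+ℝ-cancelʳ-≤ : ∀ {x y z w : ℝ} → x +ℝ y ≤ℝ z +ℝ w → w ≤ℝ y → x ≤ℝ z
+ℝ-cancelʳ-≤ {x} {y} {z} {w} = ≤ℝ-combine {x +ℝ y} {z +ℝ w} {w} {y} {x} {z}
  λ n δ xy≤zw w≤y → begin
  seq x n
    ≡⟨ move (seq x n) (seq y n) ⟩
  (seq x n ℚ.+ seq y n) ℚ.- seq y n
    ≤⟨ ℚ.+-monoˡ-≤ (ℚ.- seq y n) xy≤zw ⟩
  (seq z n ℚ.+ seq w n ℚ.+ δ) ℚ.- seq y n
    ≤⟨ ℚ.+-monoˡ-≤ (ℚ.- seq y n) (ℚ.+-monoˡ-≤ δ (ℚ.+-monoʳ-≤ (seq z n) w≤y)) ⟩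
  (seq z n ℚ.+ (seq y n ℚ.+ δ) ℚ.+ δ) ℚ.- seq y n
    ≡⟨ collect (seq z n) (seq y n) δ ⟩
  seq z n ℚ.+ (δ ℚ.+ δ) ∎
  where
  open ℚ.≤-Reasoning
  open +-*-Solver
  move : ∀ a b → a ≡ (a ℚ.+ b) ℚ.- b
  move = solve 2 (λ a b → a := (a :+ b) :- b) refl
  collect : ∀ a b d → (a ℚ.+ (b ℚ.+ d) ℚ.+ d) ℚ.- b ≡ a ℚ.+ (d ℚ.+ d)
  collect = solve 3 (λ a b d → (a :+ (b :+ d) :+ d) :- b := a :+ (d :+ d)) refl

ι : ℕ → ℝ
ι k = mkℝ (λ _ → k · 1ℚ) λ ε ε>0 → 0 , λ _ _ _ _ →
  subst (λ q → ℚ.∣ q ∣ ℚ.< ε) (sym (ℚ.+-inverseʳ (k · 1ℚ))) ε>0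

·-mono-≤ : ∀ {k l} → k ℕ.≤ l → k · 1ℚ ℚ.≤ l · 1ℚ
·-mono-≤ {l = zero}  z≤n = ℚ.≤-refl
·-mono-≤ {l = suc l} z≤n = ℚ.+-mono-≤ {0ℚ} {1ℚ} {0ℚ} (ℚ.nonNegative⁻¹ 1ℚ) (·-mono-≤ {l = l} z≤n)
·-mono-≤ (s≤s k≤l)       = ℚ.+-monoʳ-≤ 1ℚ (·-mono-≤ k≤l)

pointwise-≤ : ∀ {x y : ℝ} → (∀ n → seq x n ℚ.≤ seq y n) → x ≤ℝ y
pointwise-≤ {x} {y} x≤y ε ε>0 = 0 , λ n _ → begin
  seq x n             ≤⟨ x≤y n ⟩
  seq y n             ≡⟨ sym (ℚ.+-identityʳ (seq y n)) ⟩
  seq y n ℚ.+ 0ℚ      ≤⟨ ℚ.+-monoʳ-≤ (seq y n) (ℚ.<⇒≤ ε>0) ⟩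
  seq y n ℚ.+ ε       ∎
  where open ℚ.≤-Reasoning

ι-mono-≤ : ∀ {k l} → k ℕ.≤ l → ι k ≤ℝ ι l
ι-mono-≤ {k} {l} k≤l = pointwise-≤ {ι k} {ι l} λ _ → ·-mono-≤ k≤l

ι+ι-mono-≤ : ∀ {k l m n} → k ℕ.+ l ℕ.≤ m ℕ.+ n → ι k +ℝ ι l ≤ℝ ι m +ℝ ι n
ι+ι-mono-≤ {k} {l} {m} {n} k+l≤m+n = pointwise-≤ {ι k +ℝ ι l} {ι m +ℝ ι n} λ _ →
  subst₂ ℚ._≤_ (×-homo-+ ℚ.+-0-monoid 1ℚ k l) (×-homo-+ ℚ.+-0-monoid 1ℚ m n)
    (·-mono-≤ k+l≤m+n)

ι≤ι0⇒≡0 : ∀ k → ι k ≤ℝ ι 0 → k ≡ 0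
ι≤ι0⇒≡0 zero    _  = refl
ι≤ι0⇒≡0 (suc k) le = contradiction 1≤½ (from-no (1ℚ ℚ.≤? ½))
  where
  -- Any ε below 1 separates `suc k` from 0; with ½ the bound reads 1 ≤ `suc k` ≤ ½.
  bound = le ½ (from-yes (0ℚ ℚ.<? ½))
  1≤½ : 1ℚ ℚ.≤ ½
  1≤½ = ℚ.≤-trans (·-mono-≤ {1} {suc k} (s≤s z≤n)) (proj₂ bound (proj₁ bound) ℕ.≤-refl)

∀-subset? : ∀ {n} {P : Subset n → Set} → Decidable P → Dec (∀ σ → P σ)
∀-subset? P? = map′
  (λ ∄¬P σ → decidable-stable (P? σ) λ ¬Pσ → ∄¬P (σ , ¬Pσ))
  (λ ∀P (σ , ¬Pσ) → ¬Pσ (∀P σ))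
  (¬? (anySubset? (¬? ∘ P?)))

-- Connectedness

∪-restrict : ∀ {n} {F ρ ρ′ : Subset n} → ρ ⊆ F → ρ′ ⊆ ∁ F → (ρ ∪ ρ′) ∩ F ≡ ρ
∪-restrict {F = F} {ρ} {ρ′} ρ⊆F ρ′⊆∁F = ⊆-antisym
  (λ x∈ → let x∈ρ∪ρ′ , x∈F = x∈p∩q⁻ (ρ ∪ ρ′) F x∈ in
    [ (λ x∈ρ → x∈ρ)
    , (λ x∈ρ′ → contradiction x∈F (x∈∁p⇒x∉p (ρ′⊆∁F x∈ρ′)))
    ]′ (x∈p∪q⁻ ρ ρ′ x∈ρ∪ρ′))
  (λ x∈ρ → x∈p∩q⁺ (x∈p∪q⁺ (inj₁ x∈ρ) , ρ⊆F x∈ρ))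

disjoint⇒⊆∁ : ∀ {n} {E F : Subset n} → E ∩ F ≡ ∅ → F ⊆ ∁ E
disjoint⇒⊆∁ E∩F≡∅ x∈F = x∉p⇒x∈∁p λ x∈E →
  ∉⊥ (subst (_ ∈_) E∩F≡∅ (x∈p∩q⁺ (x∈E , x∈F)))

-- In a direct sum along E, the E-part of one basis and the ∁ E-part of another
-- together form a basis, so a linked matroid is connected.
Linked : ∀ {n d} → Matroid {n} ⊤ d → Set
Linked M = ∀ E → Nonempty E → Nonempty (∁ E) →
  ∃[ τ ] (Basis M τ × ¬ Basis M ((proj₁ (nonempty M) ∩ E) ∪ (τ ∩ ∁ E)))

linked? : ∀ {n d} (M : Matroid {n} ⊤ d) → Dec (Linked M)
linked? M = ∀-subset? λ E → nonempty? E →-dec nonempty? (∁ E) →-dec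
  anySubset? λ τ → basis? M τ ×-dec
    ¬? (basis? M ((proj₁ (nonempty M) ∩ E) ∪ (τ ∩ ∁ E)))

connected : ∀ {n d} (M : Matroid {n} ⊤ d) → Linked M → Connected M
connected M linked
  (E₁ , E₂ , _ , _ , M₁ , M₂ , E₁≢∅ , (y , y∈E₂) , E₁∩E₂≡∅ , _ , iff)
  with linked E₁ E₁≢∅ (y , disjoint⇒⊆∁ E₁∩E₂≡∅ y∈E₂)
... | τ , Bτ , ¬B
  with uncurry (Equivalence.to ∘ iff) (nonempty M) | Equivalence.to (iff τ) Bτ
... | σ₁ , σ₂ , B₁σ₁ , B₂σ₂ , σ≡ | τ₁ , τ₂ , B₁τ₁ , B₂τ₂ , refl =
  ¬B (Equivalence.from (iff _) (σ₁ , τ₂ , B₁σ₁ , B₂τ₂ , cong₂ _∪_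
    (trans (cong (_∩ E₁) σ≡) (∪-restrict (ground M₁ B₁σ₁) (E₂⊆∁E₁ ∘ ground M₂ B₂σ₂)))
    -- Here `∪-restrict` is applied with `F` = `∁ E₁`, so the summands are swapped first and `τ₁`
    -- has to lie in `∁ (∁ E₁)`.
    (trans (cong (_∩ ∁ E₁) (∪-comm τ₁ τ₂))
      (∪-restrict (E₂⊆∁E₁ ∘ ground M₂ B₂τ₂)
        (x∉p⇒x∈∁p ∘ x∈p⇒x∉∁p ∘ ground M₁ B₁τ₁)))))
  where E₂⊆∁E₁ = disjoint⇒⊆∁ E₁∩E₂≡∅

-- Initial matroids from weights in ℕ

ℕ∞ : Set
ℕ∞ = Maybe ℕ

infix 4 _≤ℕ∞_
_≤ℕ∞_ : ℕ∞ → ℕ∞ → Set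
_≤ℕ∞_ = Sup≤ ℕ._≤_

infixl 6 _+ℕ∞_
_+ℕ∞_ : ℕ∞ → ℕ∞ → ℕ∞
_+ℕ∞_ = zipWith ℕ._+_

ι∞ : ℕ∞ → ℝ∞
ι∞ = Maybe.map ι

-- The summands stay separate because `ι k +ℝ ι l` and `ι (k + l)` are different representatives of
-- one real, while the Dressian condition mentions the former.
Term : Set
Term = ℕ∞ × ℕ∞

⟦_⟧ : Term → ℝ∞
⟦ a , b ⟧ = ι∞ a +∞ ι∞ b

infix 4 _≼_
_≼_ : Term → Term → Set
(a , b) ≼ (c , d) = a +ℕ∞ b ≤ℕ∞ c +ℕ∞ d

_≼?_ : ∀ s t → Dec (s ≼ t)
(a , b) ≼? (c , d) = ≤⁺-dec ℕ._≤_ ℕ._≤?_ (a +ℕ∞ b) (c +ℕ∞ d)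

≼⇒≤∞ : ∀ s t → s ≼ t → ⟦ s ⟧ ≤∞ ⟦ t ⟧
≼⇒≤∞ _                 (nothing , _)       _      = _ ≤⊤⁺
≼⇒≤∞ _                 (just _ , nothing)  _      = _ ≤⊤⁺
≼⇒≤∞ (just k , just l) (just m , just n) ≤[ le ] = ≤[ ι+ι-mono-≤ {k} {l} {m} {n} le ]

TermMinAttainedTwice : List Term → Set
TermMinAttainedTwice ts = ∃₂ λ a b → a ≢ b × IsMin a × IsMin b
  where
  IsMin : Fin _ → Set
  IsMin a = ∀ c → lookup ts a ≼ lookup ts c

termMinAttainedTwice? : ∀ ts → Dec (TermMinAttainedTwice ts)
termMinAttainedTwice? ts = Fin.any? λ a → Fin.any? λ b →
  ¬? (a Fin.≟ b) ×-dec isMin? a ×-dec isMin? b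
  where
  isMin? : ∀ a → Dec (∀ c → lookup ts a ≼ lookup ts c)
  isMin? a = Fin.all? λ c → lookup ts a ≼? lookup ts c

minAttainedTwice : ∀ r s t → TermMinAttainedTwice (r ∷ s ∷ t ∷ []) →
  MinAttainedTwice (⟦ r ⟧ ∷ ⟦ s ⟧ ∷ ⟦ t ⟧ ∷ [])
minAttainedTwice r s t (a , b , a≢b , min-a , min-b) =
  a , b , a≢b , transfer a min-a , transfer b min-b
  where
  terms  = r ∷ s ∷ t ∷ []
  values = ⟦ r ⟧ ∷ ⟦ s ⟧ ∷ ⟦ t ⟧ ∷ []
  lookup-value : ∀ c → lookup values c ≡ ⟦ lookup terms c ⟧
  lookup-value 0F = refl
  lookup-value 1F = refl
  lookup-value 2F = refl
  transfer : ∀ a → (∀ c → lookup terms a ≼ lookup terms c) →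
             ∀ c → lookup values a ≤∞ lookup values c
  transfer a min c = subst₂ _≤∞_ (sym (lookup-value a)) (sym (lookup-value c))
    (≼⇒≤∞ (lookup terms a) (lookup terms c) (min c))

module _ {n d : ℕ} (M : Matroid {n} ⊤ d) (w : Subset n → ℕ) where

  extendℕ : Subset n → ℕ∞
  extendℕ σ with basis? M σ
  ... | yes _ = just (w σ)
  ... | no  _ = nothing

  extend-ι : ∀ σ → extend M (λ σ _ → ι (w σ)) σ ≡ ι∞ (extendℕ σ)
  extend-ι σ with basis? M σ
  ... | yes _ = refl
  ... | no  _ = refl

  ThreeTerm : Subset n → Fin n → Fin n → Fin n → Fin n → Set
  ThreeTerm S i j k l = TermMinAttainedTwice
    ((u i j , u k l) ∷ (u i k , u j l) ∷ (u i l , u j k) ∷ [])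
    where
    u : Fin n → Fin n → ℕ∞
    u a b = extendℕ (S ∪ ⁅ a ⁆ ∪ ⁅ b ⁆)

  -- The conditions are interleaved with the quantifiers to prune the
  -- exhaustive search.
  Tropical : Set
  Tropical = ∀ S → 2 ℕ.+ ∣ S ∣ ≡ d →
    ∀ i → i ∉ S → ∀ j → j ∉ S × i ≢ j →
    ∀ k → k ∉ S × i ≢ k × j ≢ k → ∀ l → l ∉ S × i ≢ l × j ≢ l × k ≢ l →
    ThreeTerm S i j k l

  tropical? : Dec Tropical
  tropical? = ∀-subset? λ S → (2 ℕ.+ ∣ S ∣ ℕ.≟ d) →-dec
    Fin.all? λ i → ¬? (i ∈? S) →-dec
    Fin.all? λ j → (¬? (j ∈? S) ×-dec i ≢? j) →-dec
    Fin.all? λ k → (¬? (k ∈? S) ×-dec i ≢? k ×-dec j ≢? k) →-dec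
    Fin.all? λ l → (¬? (l ∈? S) ×-dec i ≢? l ×-dec j ≢? l ×-dec k ≢? l) →-dec
    termMinAttainedTwice? _
    where
    _≢?_ : ∀ (x y : Fin n) → Dec (x ≢ y)
    x ≢? y = ¬? (x Fin.≟ y)

  inDressian : Tropical → InDressian M (λ σ _ → ι (w σ))
  inDressian trop S ∣S∣ i j k l
    ((i≢j ∷ i≢k ∷ i≢l ∷ []) ∷ (j≢k ∷ j≢l ∷ []) ∷ (k≢l ∷ []) ∷ [] ∷ [])
    (i∉S ∷ j∉S ∷ k∉S ∷ l∉S ∷ [])
    = subst MinAttainedTwice
        (cong₂ _∷_ (value (S ∪ ⁅ i ⁆ ∪ ⁅ j ⁆) (S ∪ ⁅ k ⁆ ∪ ⁅ l ⁆))
        (cong₂ _∷_ (value (S ∪ ⁅ i ⁆ ∪ ⁅ k ⁆) (S ∪ ⁅ j ⁆ ∪ ⁅ l ⁆))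
        (cong₂ _∷_ (value (S ∪ ⁅ i ⁆ ∪ ⁅ l ⁆) (S ∪ ⁅ j ⁆ ∪ ⁅ k ⁆)) refl)))
        (minAttainedTwice _ _ _
          (trop S ∣S∣ i i∉S j (j∉S , i≢j) k (k∉S , i≢k , j≢k) l (l∉S , i≢l , j≢l , k≢l)))
    where
    value : ∀ σ τ → ⟦ extendℕ σ , extendℕ τ ⟧ ≡
      extend M (λ σ _ → ι (w σ)) σ +∞ extend M (λ σ _ → ι (w σ)) τ
    value σ τ = sym (cong₂ _+∞_ (extend-ι σ) (extend-ι τ))

-- Some basis of `M′` exists and has weight 0, so 0 is the minimum of `w` on the bases of `M`, and
-- being minimal means having weight 0.
initial-of-ℕ-weight : ∀ {n d} (M M′ : Matroid {n} ⊤ d) (w : Subset n → ℕ) →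
  Tropical M w → (∀ σ → Basis M′ σ ⇔ (Basis M σ × w σ ≡ 0)) →
  M′ IsInitialMatroidOf M
initial-of-ℕ-weight M M′ w trop iff = (λ σ _ → ι (w σ)) , inDressian M w trop , λ σ → mk⇔
  (λ Bσ → let BMσ , wσ≡0 = Equivalence.to (iff σ) Bσ in
    BMσ , λ τ _ → ι-mono-≤ (subst (ℕ._≤ w τ) (sym wσ≡0) z≤n))
  (λ (BMσ , min) → Equivalence.from (iff σ) (BMσ , ι≤ι0⇒≡0 (w σ)
    (subst (λ k → ι (w σ) ≤ℝ ι k) wρ≡0 (min ρ BMρ))))
  where
  ρ = proj₁ (nonempty M′)
  BMρ = proj₁ (Equivalence.to (iff ρ) (proj₂ (nonempty M′)))
  wρ≡0 = proj₂ (Equivalence.to (iff ρ) (proj₂ (nonempty M′)))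

-- Matroids given by rank bounds

Bounds : ℕ → Set
Bounds n = List (Subset n × ℕ)

IsBasis : ∀ {n} → ℕ → Bounds n → Subset n → Set
IsBasis d bs σ = ∣ σ ∣ ≡ d × All (λ (X , r) → ∣ σ ∩ X ∣ ℕ.≤ r) bs

isBasis? : ∀ {n} d (bs : Bounds n) → Decidable (IsBasis d bs)
isBasis? d bs σ = ∣ σ ∣ ℕ.≟ d ×-dec All.all? (λ (X , r) → ∣ σ ∩ X ∣ ℕ.≤? r) bs

module _ {n : ℕ} {P : Subset n → Set} (P? : Decidable P) where

  Exchange : Set
  Exchange = ∀ σ → P σ → ∀ τ → P τ → ∀ x → x ∈ σ → x ∉ τ →
             ∃[ y ] (y ∈ τ × y ∉ σ × P ((σ - x) ∪ ⁅ y ⁆))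

  exchange? : Dec Exchange
  exchange? =
    ∀-subset? λ σ → P? σ →-dec ∀-subset? λ τ → P? τ →-dec
    Fin.all? λ x → x ∈? σ →-dec ¬? (x ∈? τ) →-dec
    Fin.any? λ y → y ∈? τ ×-dec ¬? (y ∈? σ) ×-dec P? ((σ - x) ∪ ⁅ y ⁆)

-- Arbitrary rank bounds need not define a matroid. For closed arguments both implicit conditions
-- are settled by evaluation, the exchange property by a search over all pairs of bases.
bounded : ∀ {n} d (bs : Bounds n) ρ →
          {True (isBasis? d bs ρ)} → {True (exchange? (isBasis? d bs))} →
          Matroid {n} ⊤ d
bounded d bs ρ {isBasis} {isExchange} = record
  { Basis    = IsBasis d bs
  ; basis?   = isBasis? d bs
  ; ground   = λ _ _ → ∈⊤
  ; rank     = proj₁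
  ; nonempty = ρ , toWitness isBasis
  ; exchange = λ {σ} {τ} Bσ Bτ {x} → toWitness isExchange σ Bσ τ Bτ x
  }

excess : ∀ {n} → Subset n × ℕ → Subset n → ℕ
excess (X , r) σ = ∣ σ ∩ X ∣ ∸ r

-- Truncated subtraction vanishes exactly when the bound holds, so imposing one more bound selects
-- the bases of excess 0, as `initial-of-ℕ-weight` requires.
basis-∷⇔ : ∀ {n d} b {bs : Bounds n} σ →
  IsBasis d (b ∷ bs) σ ⇔ (IsBasis d bs σ × excess b σ ≡ 0)
basis-∷⇔ b σ = mk⇔
  (λ where (∣σ∣≡d , le ∷ les) → (∣σ∣≡d , les) , ℕ.m≤n⇒m∸n≡0 le)
  (λ ((∣σ∣≡d , les) , eq) → ∣σ∣≡d , ℕ.m∸n≡0⇒m≤n eq ∷ les)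

triple : ∀ {n} → Fin n → Fin n → Fin n → Subset n
triple x y z = ⁅ x ⁆ ∪ ⁅ y ⁆ ∪ ⁅ z ⁆

-- The counterexample

pattern A = 0F
pattern B = 1F
pattern C = 2F
pattern D = 3F
pattern O = 4F
pattern I = 5F
pattern P = 6F
pattern Q = 7F

quad : Subset 8
quad = ⁅ A ⁆ ∪ ⁅ B ⁆ ∪ ⁅ C ⁆ ∪ ⁅ D ⁆

lines : Bounds 8
lines =
  (triple A B O , 2) ∷ (triple C D O , 2) ∷
  (triple A D I , 2) ∷ (triple B C I , 2) ∷
  (triple A C P , 2) ∷ (triple B D Q , 2) ∷ []

quad-parallel PO-quad-collinear : Subset 8 × ℕ
quad-parallel     = quad , 1
PO-quad-collinear = ⁅ P ⁆ ∪ ⁅ O ⁆ ∪ quad , 2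

M M′ M″ : Matroid {8} ⊤ 3
-- `A I Q` is a basis of all three matroids: it meets `quad`, and also the line through `P` and `O`,
-- only in `A`. It is also the fixed basis that enters `Linked`.
M  = bounded 3 lines (triple A I Q)
M′ = bounded 3 (quad-parallel ∷ lines) (triple A I Q)
M″ = bounded 3 (PO-quad-collinear ∷ quad-parallel ∷ lines) (triple A I Q)

-- No weight in the Dressian of `M` induces `M″`

extend-basis : ∀ {n d} (M : Matroid {n} ⊤ d) (v : Weight M) {σ} (Bσ : Basis M σ) →
               extend M v σ ≡ [ v σ Bσ ]
extend-basis M v {σ} Bσ with basis? M σ
-- The proof found by `basis?` and `Bσ` are identified by the irrelevance in `Weight`.
... | yes _  = refl
... | no ¬Bσ = contradiction Bσ ¬Bσ

-- The infinite third term cannot attain a minimum that is finite, so the two distinct minimal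
-- positions are the first and the second.
first≤second : ∀ {x y : ℝ} → MinAttainedTwice ([ x ] ∷ [ y ] ∷ ⊤⁺ ∷ []) → x ≤ℝ y
first≤second (0F , _  , _   , min , _) with min 1F
... | ≤[ x≤y ] = x≤y
first≤second (1F , 0F , _   , _ , min) with min 1F
... | ≤[ x≤y ] = x≤y
first≤second (1F , 1F , 1≢1 , _)       = contradiction refl 1≢1
first≤second (1F , 2F , _   , _ , min) = case min 0F of λ ()
first≤second (2F , _  , _   , min , _) = case min 0F of λ ()

module _ (v : Weight M) (v∈Dr : InDressian M v)
         (iff : ∀ σ → Basis M″ σ ⇔ InitialBasis M v σ) where

  -- On concrete points `triple` evaluates to a bit vector and the basis proof is irrelevant, so the
  -- order of the points does not matter: `val O D A` and `val O A D` agree definitionally.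
  val : ∀ x y z {_ : True (basis? M (triple x y z))} → ℝ
  val x y z {Bσ} = v (triple x y z) (toWitness Bσ)

  minimal : ∀ x y z {_ : True (basis? M″ (triple x y z))}
            {Bσ : True (basis? M (triple x y z))} →
            ∀ τ (Bτ : Basis M τ) → val x y z {Bσ} ≤ℝ v τ Bτ
  minimal x y z {Bσ} = proj₂ (Equivalence.to (iff (triple x y z)) (toWitness Bσ))

  minimal-≤ : ∀ x y z x′ y′ z′ {_ : True (basis? M″ (triple x y z))}
              {Bσ : True (basis? M (triple x y z))}
              {Bτ : True (basis? M (triple x′ y′ z′))} →
              val x y z {Bσ} ≤ℝ val x′ y′ z′ {Bτ}
  minimal-≤ x y z x′ y′ z′ {Bσ″} {Bσ} {Bτ} =
    minimal x y z {Bσ″} {Bσ} (triple x′ y′ z′) (toWitness Bτ)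

  threeTerm : ∀ s i j k l →
    {True (unique? (i ∷ j ∷ k ∷ l ∷ []))} →
    {True (All.all? (λ x → ¬? (x ∈? ⁅ s ⁆)) (i ∷ j ∷ k ∷ l ∷ []))} →
    let w = λ a b → extend M v (triple s a b) in
    MinAttainedTwice
      ((w i j +∞ w k l) ∷ (w i k +∞ w j l) ∷ (w i l +∞ w j k) ∷ [])
  threeTerm s i j k l {distinct} {∉S} =
    v∈Dr ⁅ s ⁆ (cong (2 ℕ.+_) (∣⁅x⁆∣≡1 s)) i j k l (toWitness distinct) (toWitness ∉S)

  -- With one term infinite, the relation becomes v(sij) + v(skl) = v(sik) + v(sjl), and an
  -- inequality between v(sjl) and v(skl) passes to the other two values.
  compare : ∀ s i j k l
    {distinct : True (unique? (i ∷ j ∷ k ∷ l ∷ []))}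
    {∉S : True (All.all? (λ x → ¬? (x ∈? ⁅ s ⁆)) (i ∷ j ∷ k ∷ l ∷ []))}
    {Bij : True (basis? M (triple s i j))} {Bkl : True (basis? M (triple s k l))}
    {Bik : True (basis? M (triple s i k))} {Bjl : True (basis? M (triple s j l))} →
    extend M v (triple s i l) +∞ extend M v (triple s j k) ≡ ⊤⁺ →
    val s j l {Bjl} ≤ℝ val s k l {Bkl} → val s i j {Bij} ≤ℝ val s i k {Bik}
  compare s i j k l {distinct} {∉S} {Bij} {Bkl} {Bik} {Bjl} third≡⊤ =
    +ℝ-cancelʳ-≤ {val s i j {Bij}} {val s k l {Bkl}} {val s i k {Bik}} {val s j l {Bjl}}
      (first≤second (subst MinAttainedTwice
        (cong₂ _∷_ (cong₂ _+∞_ (extend-val i j Bij) (extend-val k l Bkl))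
        (cong₂ _∷_ (cong₂ _+∞_ (extend-val i k Bik) (extend-val j l Bjl))
        (cong₂ _∷_ third≡⊤ refl)))
        (threeTerm s i j k l {distinct} {∉S})))
    where
    extend-val : ∀ a b (Bσ : True (basis? M (triple s a b))) →
                 extend M v (triple s a b) ≡ [ val s a b {Bσ} ]
    extend-val a b Bσ = extend-basis M v (toWitness Bσ)

  -- This starts a chain OAC, OAD, OBD, IBD, IAB, IAC of bases of `M` that contain two points of the
  -- quadrangle and so are not bases of `M″`. The dependent lines OCD, OAB, BDQ, IAD, IBC supply the
  -- infinite terms in turn, each confirmed by `refl`; minimality on `M″` supplies the inequality to
  -- be carried over.
  OAC≤OAD : val O A C ≤ℝ val O A D
  OAC≤OAD = compare O A C D I refl (minimal-≤ O C I O D I)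

  ODA≤ODB : val O D A ≤ℝ val O D B
  ODA≤ODB = compare O D A B I refl (minimal-≤ O A I O B I)

  BDO≤BDI : val B D O ≤ℝ val B D I
  BDO≤BDI = compare B D O I Q refl (minimal-≤ B O Q B I Q)

  IBD≤IBA : val I B D ≤ℝ val I B A
  IBD≤IBA = compare I B D A O refl (minimal-≤ I D O I A O)

  IAB≤IAC : val I A B ≤ℝ val I A C
  IAB≤IAC = compare I A B C O refl (minimal-≤ I B O I C O)

  OAC≤IAC : val O A C ≤ℝ val I A C
  OAC≤IAC =
    ≤ℝ-trans {val O A C} {val O A D} {val I A C} OAC≤OAD
    (≤ℝ-trans {val O A D} {val O B D} {val I A C} ODA≤ODB
    (≤ℝ-trans {val O B D} {val I B D} {val I A C} BDO≤BDI
    (≤ℝ-trans {val I B D} {val I A B} {val I A C} IBD≤IBA IAB≤IAC)))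

  -- The sixth relation uses the line ACP, with the chain in place of minimality. Since `A P I` is a
  -- basis of `M″`, its value is minimal, and this forces `A P O` to be minimal too.
  APO≤API : val A P O ≤ℝ val A P I
  APO≤API = compare A P O I C refl OAC≤IAC

  contradictory : ⊥
  contradictory = from-no (basis? M″ (triple A P O))
    (Equivalence.from (iff (triple A P O))
      (toWitness {a? = basis? M (triple A P O)} _ , λ τ Bτ →
        ≤ℝ-trans {val A P O} {val A P I} {v τ Bτ} APO≤API (minimal A P I τ Bτ)))

theorem5p2 : Σ[ n ∈ ℕ ] Σ[ d ∈ ℕ ]
    Σ[ M ∈ Matroid {n} ⊤ d ] Σ[ M′ ∈ Matroid {n} ⊤ d ] Σ[ M″ ∈ Matroid {n} ⊤ d ]
    (Connected M × Connected M′ × Connected M″ ×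
    M′ IsInitialMatroidOf M ×
    M″ IsInitialMatroidOf M′ ×
    ¬ (M″ IsInitialMatroidOf M))
theorem5p2 = 8 , 3 , M , M′ , M″ ,
  connected M (from-yes (linked? M)) ,
  connected M′ (from-yes (linked? M′)) ,
  connected M″ (from-yes (linked? M″)) ,
  initial-of-ℕ-weight M M′ (excess quad-parallel)
    (from-yes (tropical? M (excess quad-parallel)))
    (basis-∷⇔ quad-parallel) ,
  initial-of-ℕ-weight M′ M″ (excess PO-quad-collinear)
    (from-yes (tropical? M′ (excess PO-quad-collinear)))
    (basis-∷⇔ PO-quad-collinear) ,
  λ (v , v∈Dr , iff) → contradictory v v∈Dr iff
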